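{- The system $\mathbf{KB5'}^\blacktriangle$ is sound and strongly complete with respect to the class of symmetric and Euclidean frames ($\mathcal{B}5$-frames); thus it is also sound and strongly complete with respect to the class of reflexive and Euclidean frames ($\mathcal{S}5$-frames).
   Context: Let $\mathbf{P}$ be a set of propositional variables containing distinct variables $p,q$. $\mathcal{L}(\blacktriangle)$-formulas: $\varphi::=\top\mid p\mid\neg\varphi\mid(\varphi\land\varphi)\mid\blacktriangle\varphi$ with $p\in\mathbf{P}$; other Boolean connectives are defined as usual. A frame is $\langle S,R\rangle$ with $S$ nonempty, $R\subseteq S\times S$; a model on it adds $V:\mathbf{P}\to\mathcal{P}(S)$. Euclidean: $sRt$ and $sRu$ imply $tRu$. Truth: $\top$, variables, $\neg,\land$ as usual; $\mathcal{M},s\vDash\blacktriangle\varphi$ iff (if $\mathcal{M},s\vDash\varphi$ then $\mathcal{M},t\vDash\varphi$ for all $t$ with $sRt$) and (if $\mathcal{M},s\nvDash\varphi$ then $\mathcal{M},t\nvDash\varphi$ for all $t$ with $sRt$). $\Gamma$ entails $\varphi$ over a class of frames if $\Gamma\cup\{\neg\varphi\}$ is not satisfied at any point of any model based on a frame in the class. The axiomatic system $\mathbf{K}^\blacktriangle$ has as axioms all propositional tautologies and $\blacktriangle\top$; $\ \blacktriangle\neg p\leftrightarrow\blacktriangle p$; $\ \blacktriangle p\land\blacktriangle q\to\blacktriangle(p\land q)$; and as rules uniform substitution, modus ponens, and R: from $\varphi\to\psi$ infer $\blacktriangle\varphi\land\varphi\to\blacktriangle\psi$. $\mathbf{KB5'}^\blacktriangle$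 is $\mathbf{K}^\blacktriangle$ plus the two axioms $p\to\blacktriangle(\blacktriangle p\to p)$ and $p\land\neg\blacktriangle p\to\blacktriangle(p\land\blacktriangle p)$. A theorem ($\vdash\varphi$) is a formula derivable from the empty set of premises. $\Gamma\vdash\varphi$ means $\vdash\gamma_1\land\cdots\land\gamma_n\to\varphi$ for some finitely many $\gamma_i\in\Gamma$ (with $\vdash\varphi$ when $n=0$). Sound with respect to a class of frames: every theorem is valid on every frame of the class. Strongly complete with respect to a class: for all $\Gamma\cup\{\varphi\}\subseteq\mathcal{L}(\blacktriangle)$, if $\Gamma$ entails $\varphi$ over the class then $\Gamma\vdash\varphi$. -}

module Defs where

open import Data.Bool.Base as Bool using (Bool; true)
open import Data.List.Base using (List; []; _∷_)
open import Data.List.Relation.Unary.All using (All)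
open import Data.Product.Base using (_×_; ∃-syntax)
open import Data.Unit.Polymorphic.Base using () renaming (⊤ to Unit)
open import Level using (Level; suc)
open import Relation.Binary.Core using (Rel)
open import Relation.Binary.Definitions using (Reflexive; Symmetric)
open import Relation.Binary.PropositionalEquality.Core using (_≡_)
open import Relation.Nullary.Negation.Core using (¬_)
open import Relation.Unary using (Pred; _∈_; _∪_; ｛_｝)

private
  variable
    ℓ ℓ′ : Level
    P : Set ℓ

infix  9 ~_ ▲_
infixr 8 _∧_
infixr 7 _⇒_
infix  6 _⇔_

data Formula (P : Set ℓ) : Set ℓ where
  top : Formula P
  var : P → Formula P
  ~_  : Formula P → Formula P
  _∧_ : Formula P → Formula P → Formula P
  ▲_  : Formula P → Formula P

_⇒_ : Formula P → Formula P → Formula P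
φ ⇒ ψ = ~ (φ ∧ ~ ψ)

_⇔_ : Formula P → Formula P → Formula P
φ ⇔ ψ = (φ ⇒ ψ) ∧ (ψ ⇒ φ)

-- Simultaneous uniform substitution.
_[_] : Formula P → (P → Formula P) → Formula P
top     [ σ ] = top
var r   [ σ ] = σ r
(~ φ)   [ σ ] = ~ (φ [ σ ])
(φ ∧ ψ) [ σ ] = (φ [ σ ]) ∧ (ψ [ σ ])
(▲ φ)   [ σ ] = ▲ (φ [ σ ])

record Frame ℓ : Set (suc ℓ) where
  field
    World    : Set ℓ
    nonempty : World
    _⟶_      : Rel World ℓ

record Model (P : Set ℓ) : Set (suc ℓ) where
  field
    frame : Frame ℓ
  open Frame frame public
  field
    val : P → Pred World ℓ

open Frame using (World)

infix 4 _,_⊨_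
_,_⊨_ : {P : Set ℓ} (M : Model P) → Model.World M → Formula P → Set ℓ
M , s ⊨ top   = Unit
M , s ⊨ var r = s ∈ Model.val M r
M , s ⊨ ~ φ   = ¬ (M , s ⊨ φ)
M , s ⊨ φ ∧ ψ = (M , s ⊨ φ) × (M , s ⊨ ψ)
M , s ⊨ ▲ φ   = (M , s ⊨ φ → ∀ t → s ⟶ t → M , t ⊨ φ)
              × (¬ (M , s ⊨ φ) → ∀ t → s ⟶ t → ¬ (M , t ⊨ φ))
  where open Model M

FrameClass : ∀ ℓ → Set (suc ℓ)
FrameClass ℓ = Pred (Frame ℓ) ℓ

Euclidean : {S : Set ℓ} → Rel S ℓ′ → Set _
Euclidean _⟶_ = ∀ {s t u} → s ⟶ t → s ⟶ u → t ⟶ u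

𝓑5-frames : FrameClass ℓ
𝓑5-frames F = Symmetric (Frame._⟶_ F) × Euclidean (Frame._⟶_ F)

𝓢5-frames : FrameClass ℓ
𝓢5-frames F = Reflexive (Frame._⟶_ F) × Euclidean (Frame._⟶_ F)

ValidOn : {P : Set ℓ} → Frame ℓ → Formula P → Set (suc ℓ)
ValidOn {P = P} F φ =
  (V : P → Pred (World F) _) (s : World F) →
  record { frame = F ; val = V } , s ⊨ φ

Entails : {P : Set ℓ} → FrameClass ℓ → Pred (Formula P) ℓ → Formula P →
          Set (suc ℓ)
Entails {P = P} 𝓒 Γ φ =
  (M : Model P) → Model.frame M ∈ 𝓒 → (s : Model.World M) →
  ¬ (∀ ψ → ψ ∈ Γ ∪ ｛ ~ φ ｝ → M , s ⊨ ψ)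

-- Classical propositional evaluation; formulas ▲ φ count as atoms, whose
-- values are given by β φ.
eval : (P → Bool) → (Formula P → Bool) → Formula P → Bool
eval α β top     = true
eval α β (var r) = α r
eval α β (~ φ)   = Bool.not (eval α β φ)
eval α β (φ ∧ ψ) = eval α β φ Bool.∧ eval α β ψ
eval α β (▲ φ)   = β φ

Tautology : {P : Set ℓ} → Formula P → Set ℓ
Tautology φ = ∀ α β → eval α β φ ≡ true

-- The axioms are single formulas in the fixed variables p and q; their other
-- instances come from the substitution rule of Theorem.
data K▲ {P : Set ℓ} (p q : P) : Pred (Formula P) ℓ where
  taut : ∀ {φ} → Tautology φ → K▲ p q φ
  ▲⊤   : K▲ p q (▲ top)
  ▲↔   : K▲ p q (▲ ~ var p ⇔ ▲ var p)
  ▲∧   : K▲ p q (▲ var p ∧ ▲ var q ⇒ ▲ (var p ∧ var q))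

data KB5′▲ {P : Set ℓ} (p q : P) : Pred (Formula P) ℓ where
  K▲-axiom : ∀ {φ} → K▲ p q φ → KB5′▲ p q φ
  ▲B       : KB5′▲ p q (var p ⇒ ▲ (▲ var p ⇒ var p))
  ▲5′      : KB5′▲ p q (var p ∧ ~ ▲ var p ⇒ ▲ (var p ∧ ▲ var p))

data Theorem {P : Set ℓ} (Ax : Pred (Formula P) ℓ) : Pred (Formula P) ℓ where
  axiom : ∀ {φ} → φ ∈ Ax → Theorem Ax φ
  US    : ∀ {φ} (σ : P → Formula P) → Theorem Ax φ → Theorem Ax (φ [ σ ])
  MP    : ∀ {φ ψ} → Theorem Ax (φ ⇒ ψ) → Theorem Ax φ → Theorem Ax ψ
  R     : ∀ {φ ψ} → Theorem Ax (φ ⇒ ψ) → Theorem Ax (▲ φ ∧ φ ⇒ ▲ ψ)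

⋀ : Formula P → List (Formula P) → Formula P
⋀ γ []       = γ
⋀ γ (δ ∷ δs) = γ ∧ ⋀ δ δs

_⋀⇒_ : List (Formula P) → Formula P → Formula P
[]       ⋀⇒ φ = φ
(γ ∷ γs) ⋀⇒ φ = ⋀ γ γs ⇒ φ

Derivable : {P : Set ℓ} → Pred (Formula P) ℓ → Pred (Formula P) ℓ →
            Formula P → Set ℓ
Derivable Ax Γ φ = ∃[ γs ] All (_∈ Γ) γs × Theorem Ax (γs ⋀⇒ φ)

Sound : {P : Set ℓ} → Pred (Formula P) ℓ → FrameClass ℓ → Set (suc ℓ)
Sound Ax 𝓒 = ∀ φ → Theorem Ax φ → ∀ F → F ∈ 𝓒 → ValidOn F φ

StronglyComplete : {P : Set ℓ} → Pred (Formula P) ℓ → FrameClass ℓ →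
                   Set (suc ℓ)
StronglyComplete Ax 𝓒 = ∀ Γ φ → Entails 𝓒 Γ φ → Derivable Ax Γ φ

{-# OPTIONS --safe #-}

-- Put □ φ = φ ∧ ▲ φ.  In KB5′▲ this □ is an S5 modality, and ▲ φ is
-- equivalent to □ φ ∨ □ ~ φ, so the canonical model whose accessibility
-- relation is read off □ is reflexive and Euclidean.  This gives strong
-- completeness for 𝓢5-frames, hence for the larger class of 𝓑5-frames.
-- The maximal consistent sets come from a Teichmüller–Tukey lemma: excluded
-- middle for arbitrary types yields a choice function, and Bool-valued subsets
-- keep the whole transfinite construction inside Set ℓ.

module Submission where

open import Axiom.ExcludedMiddle using (ExcludedMiddle)
open import Axiom.Extensionality.Propositional using (Extensionality; lower-extensionality)
open import Data.Bool.Base as Bool using (Bool; true; false; not)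
open import Data.Bool.Properties using (⇔→≡; ¬-not; not-¬; ∧-conicalˡ; ∧-conicalʳ)
open import Data.Empty using (⊥; ⊥-elim)
open import Data.List.Base using (List; []; _∷_; _++_; foldr)
open import Data.List.Relation.Unary.All as All using (All; []; _∷_)
open import Data.List.Relation.Unary.All.Properties using (++⁺)
open import Data.Product.Base using (_×_; _,_; proj₁; proj₂; ∃; ∃-syntax)
open import Data.Sum.Base using (_⊎_; inj₁; inj₂; [_,_]′)
open import Function.Base using (_∘_; id)
open import Function.Bundles using (mk⇔)
open import Level using (Level; _⊔_; 0ℓ; Lift; lift; lower)
open import Relation.Binary.PropositionalEquality.Core using (_≡_; _≢_; refl; sym; trans; cong; cong₂; subst₂)
open import Relation.Nullary.Decidable using (yes; no; does; proof; decidable-stable)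
open import Relation.Nullary.Negation.Core using (¬_; contradiction)
open import Relation.Nullary.Reflects using (Reflects; ofʸ; ofⁿ; ⊤-reflects; ¬-reflects; _×-reflects_)
open import Relation.Unary using (Pred; _∈_; _∪_; ｛_｝)
open import Defs

private
  variable
    a ℓ : Level
    P : Set ℓ

reflects-true : {A : Set a} {b : Bool} → Reflects A b → b ≡ true → A
reflects-true (ofʸ a) _ = a

true-reflects : {A : Set a} {b : Bool} → Reflects A b → A → b ≡ true
true-reflects (ofʸ _)  _ = refl
true-reflects (ofⁿ ¬a) a = contradiction a ¬a

-- The Teichmüller–Tukey lemma

module Tukey (em : ExcludedMiddle ℓ) (ext : Extensionality ℓ ℓ) where

  ⟦_⟧ : {X : Set ℓ} → Pred X ℓ → X → Bool
  ⟦ Q ⟧ x = does (em {Q x})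

  ⟦⟧⁺ : {X : Set ℓ} (Q : Pred X ℓ) {x : X} → Q x → ⟦ Q ⟧ x ≡ true
  ⟦⟧⁺ Q = true-reflects (proof em)

  ⟦⟧⁻ : {X : Set ℓ} (Q : Pred X ℓ) {x : X} → ⟦ Q ⟧ x ≡ true → Q x
  ⟦⟧⁻ Q = reflects-true (proof em)

  module _ {X : Set ℓ} (Fin : Pred (List X) ℓ) (A₀ : Pred X ℓ) where

    Subset : Set ℓ
    Subset = X → Bool

    infix 4 _∋_ _⊑_

    _∋_ : Subset → X → Set
    A ∋ x = A x ≡ true

    _⊑_ : Subset → Subset → Set ℓ
    A ⊑ B = ∀ {x} → A ∋ x → B ∋ x

    ⊑-antisym : ∀ {A B} → A ⊑ B → B ⊑ A → A ≡ B
    ⊑-antisym A⊑B B⊑A = lower-extensionality ℓ ℓ ext (λ x → ⇔→≡ (mk⇔ A⊑B B⊑A))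

    -- A property of finite character, with `Fin` as its test on finite lists.
    Good : Pred X a → Set (a ⊔ ℓ)
    Good Q = ∀ xs → All Q xs → Fin xs

    Extension : Subset → X → Set ℓ
    Extension A x = ¬ (A ∋ x) × Good ((A ∋_) ∪ ｛ x ｝)

    -- The `yes` branch carries one particular witness, so `em` acts as a choice function: the added
    -- element depends on `A` alone.
    grow : Subset → Subset
    grow A with em {∃ (Extension A)}
    ... | yes (x , _) = ⟦ (A ∋_) ∪ ｛ x ｝ ⟧
    ... | no _        = A

    grow-⊒ : ∀ A → A ⊑ grow A
    grow-⊒ A with em {∃ (Extension A)}
    ... | yes (x , _) = λ A∋y → ⟦⟧⁺ ((A ∋_) ∪ ｛ x ｝) (inj₁ A∋y)
    ... | no _        = id

    grow-good : ∀ A → Good (A ∋_) → Good (grow A ∋_)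
    grow-good A good with em {∃ (Extension A)}
    ... | yes (x , _ , good′) = λ xs → good′ xs ∘ All.map (⟦⟧⁻ ((A ∋_) ∪ ｛ x ｝))
    ... | no _                = good

    grow-fixed⇒maximal : ∀ A → grow A ⊑ A → ∀ x → Good ((A ∋_) ∪ ｛ x ｝) → A ∋ x
    grow-fixed⇒maximal A fixed x good with em {∃ (Extension A)}
    ... | yes (y , A∌y , _) = contradiction (fixed (⟦⟧⁺ ((A ∋_) ∪ ｛ y ｝) (inj₂ refl))) A∌y
    ... | no ¬ext with A x in A∋x
    ...   | true  = refl
    ...   | false = contradiction (x , (λ A∋x′ → not-¬ A∋x A∋x′) , good) ¬ext

    -- grow A has at most one element outside A.
    grow-covers : ∀ {A B} → A ⊑ B → B ⊑ grow A → grow A ⊑ B ⊎ B ⊑ A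
    grow-covers {A} {B} A⊑B B⊑gA with em {∃ (Extension A)}
    ... | no _        = inj₁ A⊑B
    ... | yes (x , _) with B x in B∋x
    ...   | true  = inj₁ λ gA∋y →
                      [ A⊑B , (λ { refl → B∋x }) ]′ (⟦⟧⁻ ((A ∋_) ∪ ｛ x ｝) gA∋y)
    ...   | false = inj₂ λ B∋y →
                      [ id , (λ { refl → contradiction B∋y (not-¬ B∋x) }) ]′
                        (⟦⟧⁻ ((A ∋_) ∪ ｛ x ｝) (B⊑gA B∋y))

    -- The tower of stages and its linearity

    ⋃-members : (Subset → Bool) → Pred X ℓ
    ⋃-members D x = x ∈ A₀ ⊎ ∃[ A ] D A ≡ true × A ∋ x

    ⋃ : (Subset → Bool) → Subset
    ⋃ D = ⟦ ⋃-members D ⟧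

    -- Zermelo's tower. Its bottom is the `limit` of the empty family, which is `A₀` because every
    -- union includes `A₀`.
    data Tower : Pred Subset ℓ where
      step  : ∀ {A} → Tower A → Tower (grow A)
      limit : ∀ {D} → (∀ {A} → D A ≡ true → Tower A) → Tower (⋃ D)

    A₀-⊑ : ∀ {A} → Tower A → ∀ {x} → x ∈ A₀ → A ∋ x
    A₀-⊑ (step {A} t)  = grow-⊒ A ∘ A₀-⊑ t
    A₀-⊑ (limit {D} _) = ⟦⟧⁺ (⋃-members D) ∘ inj₁

    ⊑-⋃ : ∀ {D A} → D A ≡ true → A ⊑ ⋃ D
    ⊑-⋃ {D} D∋A A∋x = ⟦⟧⁺ (⋃-members D) (inj₂ (_ , D∋A , A∋x))

    ⋃-⊑ : ∀ {D B} → Tower B → (∀ {A} → D A ≡ true → A ⊑ B) → ⋃ D ⊑ B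
    ⋃-⊑ {D} t D⊑B x∈⋃ with ⟦⟧⁻ (⋃-members D) x∈⋃
    ... | inj₁ x∈A₀            = A₀-⊑ t x∈A₀
    ... | inj₂ (_ , D∋A , A∋x) = D⊑B D∋A A∋x

    Comparable : Subset → Set ℓ
    Comparable A = ∀ {B} → Tower B → A ⊑ B ⊎ B ⊑ A

    split : ∀ {D : Subset → Bool} {Q S : Pred Subset ℓ} →
            (∀ {A} → D A ≡ true → Q A ⊎ S A) →
            (∃[ A ] D A ≡ true × Q A) ⊎ (∀ {A} → D A ≡ true → S A)
    split {D} {Q} h with em {∃[ A ] D A ≡ true × Q A}
    ... | yes q = inj₁ q
    ... | no ¬q = inj₂ λ D∋A → [ (λ q → contradiction (_ , D∋A , q) ¬q) , id ]′ (h D∋A)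

    -- Induction on `B`. The delicate case is `B ⊑ A ⊑ grow B`, where `grow-covers` forces `A` to
    -- agree with one of the two ends.
    comparable⇒grow : ∀ {A} → Tower A → Comparable A →
                      ∀ {B} → Tower B → grow A ⊑ B ⊎ B ⊑ A
    comparable⇒grow {A} tA cmp (step {B} tB) with comparable⇒grow tA cmp tB
    ... | inj₁ gA⊑B = inj₁ (grow-⊒ B ∘ gA⊑B)
    ... | inj₂ B⊑A with cmp (step tB)
    ...   | inj₂ gB⊑A = inj₂ gB⊑A
    ...   | inj₁ A⊑gB with grow-covers B⊑A A⊑gB
    ...     | inj₁ gB⊑A = inj₂ gB⊑A
    -- The choice inside `grow` depends on the subset, so mutual inclusion is first turned into
    -- equality.
    ...     | inj₂ A⊑B rewrite ⊑-antisym {A} {B} A⊑B B⊑A = inj₁ id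
    comparable⇒grow {A} tA cmp (limit {D} tD)
      with split {D} {grow A ⊑_} {_⊑ A} (λ D∋B → comparable⇒grow tA cmp (tD D∋B))
    ... | inj₁ (_ , D∋B , gA⊑B) = inj₁ (⊑-⋃ D∋B ∘ gA⊑B)
    ... | inj₂ D⊑A              = inj₂ (⋃-⊑ tA D⊑A)

    comparable : ∀ {A} → Tower A → Comparable A
    comparable (step {A} tA) tB with comparable⇒grow tA (comparable tA) tB
    ... | inj₁ gA⊑B = inj₁ gA⊑B
    ... | inj₂ B⊑A  = inj₂ (grow-⊒ A ∘ B⊑A)
    comparable (limit {D} tD) {B} tB
      with split {D} {B ⊑_} {_⊑ B} (λ D∋A → [ inj₂ , inj₁ ]′ (comparable (tD D∋A) tB))
    ... | inj₁ (_ , D∋A , B⊑A) = inj₂ (⊑-⋃ D∋A ∘ B⊑A)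
    ... | inj₂ D⊑B             = inj₁ (⋃-⊑ tB D⊑B)

    -- Stages form a chain, so the finitely many stages containing the entries have a largest one.
    -- The first alternative covers lists that use `A₀` alone, including the case of an empty `D`.
    ⋃-finite : ∀ {D} → (∀ {A} → D A ≡ true → Tower A) → ∀ {xs} →
               All (⋃-members D) xs →
               All A₀ xs ⊎ (∃[ A ] D A ≡ true × All (A ∋_) xs)
    ⋃-finite tD []       = inj₁ []
    ⋃-finite tD (h ∷ hs) with h | ⋃-finite tD hs
    ... | inj₁ x∈A₀ | inj₁ xs⊆A₀ = inj₁ (x∈A₀ ∷ xs⊆A₀)
    ... | inj₁ x∈A₀ | inj₂ (A , D∋A , xs⊆A) = inj₂ (A , D∋A , A₀-⊑ (tD D∋A) x∈A₀ ∷ xs⊆A)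
    ... | inj₂ (A , D∋A , A∋x) | inj₁ xs⊆A₀ =
      inj₂ (A , D∋A , A∋x ∷ All.map (A₀-⊑ (tD D∋A)) xs⊆A₀)
    ... | inj₂ (A , D∋A , A∋x) | inj₂ (B , D∋B , xs⊆B)
      with comparable (tD D∋A) (tD D∋B)
    ...   | inj₁ A⊑B = inj₂ (B , D∋B , A⊑B A∋x ∷ xs⊆B)
    ...   | inj₂ B⊑A = inj₂ (A , D∋A , A∋x ∷ All.map B⊑A xs⊆B)

    tower-good : Good A₀ → ∀ {A} → Tower A → Good (A ∋_)
    tower-good good (step {A} tA)  = grow-good A (tower-good good tA)
    tower-good good (limit {D} tD) xs xs⊆⋃
      with ⋃-finite tD (All.map (⟦⟧⁻ (⋃-members D)) xs⊆⋃)
    ... | inj₁ xs⊆A₀            = good xs xs⊆A₀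
    ... | inj₂ (_ , D∋A , xs⊆A) = tower-good good (tD D∋A) xs xs⊆A

    -- The union `M` of all stages is itself a stage, hence so is `grow M`. Thus `grow M ⊑ M`, and
    -- nothing can be added to `M`.
    maximal-extension : Good A₀ →
      ∃[ M ] (∀ {x} → x ∈ A₀ → M ∋ x) × Good (M ∋_) ×
             (∀ x → Good ((M ∋_) ∪ ｛ x ｝) → M ∋ x)
    maximal-extension good =
      M , A₀-⊑ tM , tower-good good tM ,
      grow-fixed⇒maximal M (⊑-⋃ {⟦ Tower ⟧} (⟦⟧⁺ Tower (step tM)))
      where
      M : Subset
      M = ⋃ ⟦ Tower ⟧

      tM : Tower M
      tM = limit (⟦⟧⁻ Tower)

-- Propositional reasoning

-- Satisfied both by truth-table evaluation and by characteristic functions of maximal consistent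
-- sets, so the rules below serve for both.
record Boolean {P : Set ℓ} (v : Formula P → Bool) : Set ℓ where
  field
    v-top : v top ≡ true
    v-~   : ∀ φ → v (~ φ) ≡ not (v φ)
    v-∧   : ∀ φ ψ → v (φ ∧ ψ) ≡ v φ Bool.∧ v ψ

  ~-intro : ∀ {φ} → ¬ (v φ ≡ true) → v (~ φ) ≡ true
  ~-intro {φ} φ-false = trans (v-~ φ) (sym (¬-not (φ-false ∘ sym)))

  ~-elim : ∀ {φ} → v (~ φ) ≡ true → ¬ (v φ ≡ true)
  ~-elim {φ} ~φ φ-true = not-¬ refl (trans (sym ~φ) (trans (v-~ φ) (cong not φ-true)))

  ~~-elim : ∀ {φ} → v (~ ~ φ) ≡ true → v φ ≡ true
  ~~-elim {φ} ~~φ with v φ in φ-value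
  ... | true  = refl
  ... | false = contradiction (~-intro (not-¬ φ-value)) (~-elim ~~φ)

  ∧-intro : ∀ {φ ψ} → v φ ≡ true → v ψ ≡ true → v (φ ∧ ψ) ≡ true
  ∧-intro {φ} {ψ} hφ hψ = trans (v-∧ φ ψ) (cong₂ Bool._∧_ hφ hψ)

  ∧-elimˡ : ∀ {φ ψ} → v (φ ∧ ψ) ≡ true → v φ ≡ true
  ∧-elimˡ {φ} {ψ} h = ∧-conicalˡ _ _ (trans (sym (v-∧ φ ψ)) h)

  ∧-elimʳ : ∀ {φ ψ} → v (φ ∧ ψ) ≡ true → v ψ ≡ true
  ∧-elimʳ {φ} {ψ} h = ∧-conicalʳ _ _ (trans (sym (v-∧ φ ψ)) h)

  ⇒-intro : ∀ {φ ψ} → (v φ ≡ true → v ψ ≡ true) → v (φ ⇒ ψ) ≡ true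
  ⇒-intro h = ~-intro λ φ∧~ψ → ~-elim (∧-elimʳ φ∧~ψ) (h (∧-elimˡ φ∧~ψ))

  ⇒-elim : ∀ {φ ψ} → v (φ ⇒ ψ) ≡ true → v φ ≡ true → v ψ ≡ true
  ⇒-elim h hφ = ~~-elim (~-intro λ ~ψ → ~-elim h (∧-intro hφ ~ψ))

open Boolean

eval-boolean : (α : P → Bool) (β : Formula P → Bool) → Boolean (eval α β)
eval-boolean α β = record { v-top = refl ; v-~ = λ _ → refl ; v-∧ = λ _ _ → refl }

infix 4 _⊫_
_⊫_ : {P : Set ℓ} → Formula P → Formula P → Set ℓ
φ ⊫ ψ = ∀ {v} → Boolean v → v φ ≡ true → v ψ ≡ true

⊫⇒tautology : {φ ψ : Formula P} → φ ⊫ ψ → Tautology (φ ⇒ ψ)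
⊫⇒tautology {φ = φ} {ψ} h α β =
  ⇒-intro (eval-boolean α β) {φ} {ψ} (h (eval-boolean α β))

-- Ending in `top` spares the separate treatment of empty and singleton lists that `_⋀⇒_` and `⋀`
-- require.
conj : List (Formula P) → Formula P
conj = foldr _∧_ top

⋀-conj : (γ : Formula P) (γs : List (Formula P)) → ⋀ γ γs ⊫ conj (γ ∷ γs)
⋀-conj γ []       b h = ∧-intro b h (v-top b)
⋀-conj γ (δ ∷ δs) b h = ∧-intro b (∧-elimˡ b h) (⋀-conj δ δs b (∧-elimʳ b h))

conj⇒-⋀⇒ : (γs : List (Formula P)) (φ : Formula P) → conj γs ⇒ φ ⊫ γs ⋀⇒ φ
conj⇒-⋀⇒ []       φ b h = ⇒-elim b h (v-top b)
conj⇒-⋀⇒ (γ ∷ γs) φ b h = ⇒-intro b (⇒-elim b h ∘ ⋀-conj γ γs b)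

conj-++ : (γs δs : List (Formula P)) {v : Formula P → Bool} → Boolean v →
          v (conj (γs ++ δs)) ≡ true → v (conj γs) ≡ true × v (conj δs) ≡ true
conj-++ []       δs b h = v-top b , h
conj-++ (γ ∷ γs) δs b h with conj-++ γs δs b (∧-elimʳ b h)
... | hγs , hδs = ∧-intro b (∧-elimˡ b h) hγs , hδs

-- The core of the deduction theorem: all occurrences of `x` are dropped from the list and replaced
-- by one conjunct in front.
discharge : {A : Pred (Formula P) a} {x : Formula P} {γs : List (Formula P)} →
            All (A ∪ ｛ x ｝) γs → ∃[ δs ] All A δs × x ∧ conj δs ⊫ conj γs
discharge [] = [] , [] , λ b _ → v-top b
discharge (inj₁ γ∈A ∷ rest) with discharge rest
... | δs , δs⊆A , h =
  _ ∷ δs , γ∈A ∷ δs⊆A , λ b t →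
    ∧-intro b (∧-elimˡ b (∧-elimʳ b t))
      (h b (∧-intro b (∧-elimˡ b t) (∧-elimʳ b (∧-elimʳ b t))))
discharge (inj₂ refl ∷ rest) with discharge rest
... | δs , δs⊆A , h = δs , δs⊆A , λ b t → ∧-intro b (∧-elimˡ b t) (h b t)

-- Soundness

module _ {P : Set ℓ} where

  _[_]ᴹ : Model P → (P → Formula P) → Model P
  M [ σ ]ᴹ = record { frame = Model.frame M ; val = λ r s → M , s ⊨ σ r }

  mutual
    -- The substitution lemma. Negation and `▲` use truth of subformulas contravariantly, so both
    -- directions are proved together.
    ⊨-[]⁺ : (M : Model P) (σ : P → Formula P) (φ : Formula P) →
            ∀ {s} → M [ σ ]ᴹ , s ⊨ φ → M , s ⊨ φ [ σ ]
    ⊨-[]⁺ M σ top     h       = h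
    ⊨-[]⁺ M σ (var r) h       = h
    ⊨-[]⁺ M σ (~ φ)   h       = h ∘ ⊨-[]⁻ M σ φ
    ⊨-[]⁺ M σ (φ ∧ ψ) (h , k) = ⊨-[]⁺ M σ φ h , ⊨-[]⁺ M σ ψ k
    ⊨-[]⁺ M σ (▲ φ)   (h , k) =
      (λ sφ t st → ⊨-[]⁺ M σ φ (h (⊨-[]⁻ M σ φ sφ) t st)) ,
      (λ ¬sφ t st → k (¬sφ ∘ ⊨-[]⁺ M σ φ) t st ∘ ⊨-[]⁻ M σ φ)

    ⊨-[]⁻ : (M : Model P) (σ : P → Formula P) (φ : Formula P) →
            ∀ {s} → M , s ⊨ φ [ σ ] → M [ σ ]ᴹ , s ⊨ φ
    ⊨-[]⁻ M σ top     h       = h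
    ⊨-[]⁻ M σ (var r) h       = h
    ⊨-[]⁻ M σ (~ φ)   h       = h ∘ ⊨-[]⁺ M σ φ
    ⊨-[]⁻ M σ (φ ∧ ψ) (h , k) = ⊨-[]⁻ M σ φ h , ⊨-[]⁻ M σ ψ k
    ⊨-[]⁻ M σ (▲ φ)   (h , k) =
      (λ sφ t st → ⊨-[]⁻ M σ φ (h (⊨-[]⁺ M σ φ sφ) t st)) ,
      (λ ¬sφ t st → k (¬sφ ∘ ⊨-[]⁻ M σ φ) t st ∘ ⊨-[]⁺ M σ φ)

  module Soundness (em : ExcludedMiddle ℓ) where

    stable : {A : Set ℓ} → ¬ ¬ A → A
    stable = decidable-stable em

    -- Truth at a point is a propositional evaluation whose atoms are decided by `em`; hence
    -- tautologies are true there.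
    eval-⊨ : (M : Model P) (s : Model.World M) (φ : Formula P) →
             Reflects (M , s ⊨ φ)
               (eval (λ r → does (em {M , s ⊨ var r})) (λ ψ → does (em {M , s ⊨ ▲ ψ})) φ)
    eval-⊨ M s top     = ⊤-reflects
    eval-⊨ M s (var r) = proof em
    eval-⊨ M s (~ φ)   = ¬-reflects (eval-⊨ M s φ)
    eval-⊨ M s (φ ∧ ψ) = eval-⊨ M s φ ×-reflects eval-⊨ M s ψ
    eval-⊨ M s (▲ φ)   = proof em

    K▲-valid : ∀ {p q φ} → K▲ p q φ → (F : Frame ℓ) → ValidOn F φ
    K▲-valid (taut {φ} t) F V s = reflects-true (eval-⊨ _ s φ) (t _ _)
    K▲-valid ▲⊤ F V s = (λ _ _ _ → _) , (λ ¬⊤ → contradiction _ ¬⊤)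
    K▲-valid ▲↔ F V s =
      (λ { ((h , k) , ¬▲p) →
             ¬▲p ((λ p t st → stable (k (λ ¬p → ¬p p) t st)) , h) }) ,
      (λ { ((h , k) , ¬▲~p) →
             ¬▲~p (k , (λ ¬¬p t st ¬tp → ¬tp (h (stable ¬¬p) t st))) })
    K▲-valid {p} {q} ▲∧ F V s (((hp , kp) , (hq , kq)) , ¬▲) =
      ¬▲ ((λ { (p , q) t st → hp p t st , hq q t st }) , refute)
      where
      refute : ¬ (V p s × V q s) → ∀ t → Frame._⟶_ F s t → ¬ (V p t × V q t)
      -- Falsity of the conjunction at `s` is traced to one conjunct, whose falsity persists along
      -- the arrow.
      refute ¬pq t st (tp , tq) with em {V p s}
      ... | yes sp = kq (λ sq → ¬pq (sp , sq)) t st tq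
      ... | no ¬sp = kp ¬sp t st tp

    axiom-valid : ∀ {p q φ} → KB5′▲ p q φ → (F : Frame ℓ) → F ∈ 𝓑5-frames → ValidOn F φ
    axiom-valid (K▲-axiom k) F _ = K▲-valid k F
    axiom-valid ▲B F (symm , _) V s (sp , ¬▲) =
      -- If `▲ p` held and `p` failed at `t`, symmetry would carry the failure of `p` back to `s`.
      ¬▲ ((λ { _ t st ((_ , k) , ¬tp) → k ¬tp s (symm st) sp }) ,
          (λ ¬h → contradiction (λ { (_ , ¬sp) → ¬sp sp }) ¬h))
    axiom-valid ▲5′ F (symm , eucl) V s ((sp , ¬▲p) , ¬▲) =
      ¬▲ ((λ { (_ , ▲p) → contradiction ▲p ¬▲p }) ,
          -- By Euclideanness `t` sees every successor `u` of `s`. So `p ∧ ▲ p` at `t` would make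
          -- `p` true at all of them, giving `▲ p` at `s`.
          (λ { _ t st (tp , (h , _)) →
                 ¬▲p ((λ _ u su → h tp u (eucl st su)) , (λ ¬sp → contradiction sp ¬sp)) }))

    theorem-valid : ∀ {p q} → Sound {P = P} (KB5′▲ p q) 𝓑5-frames
    theorem-valid _ (axiom ax) F F∈ = axiom-valid ax F F∈
    theorem-valid _ (US {φ} σ d) F F∈ V s =
      ⊨-[]⁺ (record { frame = F ; val = V }) σ φ (theorem-valid φ d F F∈ _ s)
    theorem-valid ψ (MP d e) F F∈ V s = stable λ ¬ψ →
      theorem-valid _ d F F∈ V s (theorem-valid _ e F F∈ V s , ¬ψ)
    theorem-valid _ (R {φ} {ψ} d) F F∈ V s (((h , _) , sφ) , ¬▲) =
      ¬▲ ((λ _ t st → mp t (h sφ t st)) , (λ ¬sψ → contradiction (mp s sφ) ¬sψ))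
      where
      M : Model P
      M = record { frame = F ; val = V }

      mp : ∀ t → M , t ⊨ φ → M , t ⊨ ψ
      mp t tφ = stable λ ¬tψ → theorem-valid _ d F F∈ V t (tφ , ¬tψ)

-- Completeness

module Completeness (em : ExcludedMiddle ℓ) (ext : Extensionality ℓ ℓ)
                    {P : Set ℓ} (p q : P) (p≢q : p ≢ q) where

  -- Axiom instances and derived rules

  infix 4 ⊢_
  ⊢_ : Formula P → Set ℓ
  ⊢_ = Theorem (KB5′▲ p q)

  ⊢-⇒ : ∀ {φ ψ} → φ ⊫ ψ → ⊢ φ ⇒ ψ
  ⊢-⇒ h = axiom (K▲-axiom (taut (⊫⇒tautology h)))

  ⊢-⊫ : ∀ {φ ψ} → φ ⊫ ψ → ⊢ φ → ⊢ ψ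
  ⊢-⊫ h = MP (⊢-⇒ h)

  ⊢-∧ : ∀ {φ ψ} → ⊢ φ → ⊢ ψ → ⊢ φ ∧ ψ
  ⊢-∧ {φ} {ψ} d = MP (⊢-⊫ (λ b hφ → ⇒-intro b (∧-intro b hφ)) d)

  ▲~-⇔ : ∀ φ → ⊢ ▲ ~ φ ⇔ ▲ φ
  ▲~-⇔ φ = US (λ _ → φ) (axiom (K▲-axiom ▲↔))

  ▲-∧ : ∀ φ ψ → ⊢ ▲ φ ∧ ▲ ψ ⇒ ▲ (φ ∧ ψ)
  ▲-∧ φ ψ = subst₂ (λ χ θ → ⊢ ▲ χ ∧ ▲ θ ⇒ ▲ (χ ∧ θ)) σp≡φ σq≡ψ
              (US σ (axiom (K▲-axiom ▲∧)))
    where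
    -- Every variable other than `p` goes to `ψ`; since `p ≢ q`, this includes `q`.
    σ : P → Formula P
    σ r with em {r ≡ p}
    ... | yes _ = φ
    ... | no _  = ψ

    σp≡φ : σ p ≡ φ
    σp≡φ with em {p ≡ p}
    ... | yes _  = refl
    ... | no p≢p = contradiction refl p≢p

    σq≡ψ : σ q ≡ ψ
    σq≡ψ with em {q ≡ p}
    ... | yes q≡p = contradiction (sym q≡p) p≢q
    ... | no _    = refl

  -- Semantically, truth at a point and at all its successors: necessity for the reflexive closure
  -- of the relation.
  □ : Formula P → Formula P
  □ φ = φ ∧ ▲ φ

  □-mono : ∀ {φ ψ} → ⊢ φ ⇒ ψ → ⊢ □ φ ⇒ □ ψ
  □-mono d = ⊢-⊫
    (λ b h → ⇒-intro b λ □φ → ∧-intro b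
      (⇒-elim b (∧-elimˡ b h) (∧-elimˡ b □φ))
      (⇒-elim b (∧-elimʳ b h) (∧-intro b (∧-elimʳ b □φ) (∧-elimˡ b □φ))))
    (⊢-∧ d (R d))

  -- Derivability, consistency and maximal consistent sets

  infix 4 _⊩_
  -- Level-polymorphic in `A`, so that it applies to premise sets and also to the small predicate
  -- `w φ ≡ true`.
  _⊩_ : Pred (Formula P) a → Formula P → Set (a ⊔ ℓ)
  A ⊩ φ = ∃[ γs ] All A γs × (⊢ conj γs ⇒ φ)

  Refutable : Pred (List (Formula P)) ℓ
  Refutable γs = ⊢ ~ conj γs

  Consistent : Pred (Formula P) a → Set (a ⊔ ℓ)
  Consistent A = ∀ γs → All A γs → ¬ Refutable γs

  ⊩-map : {A : Pred (Formula P) a} → ∀ {φ ψ} → φ ⊫ ψ → A ⊩ φ → A ⊩ ψ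
  ⊩-map h (γs , γs⊆A , d) =
    γs , γs⊆A , ⊢-⊫ (λ b t → ⇒-intro b (h b ∘ ⇒-elim b t)) d

  ⊩-∧ : {A : Pred (Formula P) a} → ∀ {φ ψ} → A ⊩ φ → A ⊩ ψ → A ⊩ φ ∧ ψ
  ⊩-∧ (γs , γs⊆A , d) (δs , δs⊆A , e) =
    γs ++ δs , ++⁺ γs⊆A δs⊆A ,
    ⊢-⊫ (λ b h → ⇒-intro b λ t → ∧-intro b
           (⇒-elim b (∧-elimˡ b h) (proj₁ (conj-++ γs δs b t)))
           (⇒-elim b (∧-elimʳ b h) (proj₂ (conj-++ γs δs b t))))
        (⊢-∧ d e)

  ⊩-refl : {A : Pred (Formula P) a} → ∀ {φ} → φ ∈ A → A ⊩ φ
  ⊩-refl φ∈A = _ ∷ [] , φ∈A ∷ [] , ⊢-⇒ (λ b → ∧-elimˡ b)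

  ⊩-theorem : {A : Pred (Formula P) a} → ∀ {φ} → ⊢ φ → A ⊩ φ
  ⊩-theorem d = [] , [] , ⊢-⊫ (λ b hφ → ⇒-intro b λ _ → hφ) d

  ⊮⇒consistent : {A : Pred (Formula P) a} → ∀ {φ} → ¬ (A ⊩ ~ φ) → Consistent (A ∪ ｛ φ ｝)
  ⊮⇒consistent A⊮~φ _ γs⊆ d with discharge γs⊆
  ... | δs , δs⊆A , h =
    A⊮~φ (δs , δs⊆A , ⊢-⊫ (λ b ~γs → ⇒-intro b λ hδs → ~-intro b λ hφ →
      ~-elim b ~γs (h b (∧-intro b hφ hδs))) d)

  -- A maximal consistent set, given by its characteristic function so that the worlds stay in
  -- `Set ℓ`.
  record State (w : Formula P → Bool) : Set ℓ where
    field
      boolean : Boolean w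
      theorem : ∀ {φ} → ⊢ φ → w φ ≡ true

    open Boolean boolean public using () renaming
      (∧-intro to w-∧-intro; ∧-elimˡ to w-∧-elimˡ; ∧-elimʳ to w-∧-elimʳ; ~-intro to w-~-intro; ~-elim to w-~-elim)

    mp : ∀ {φ ψ} → ⊢ φ ⇒ ψ → w φ ≡ true → w ψ ≡ true
    mp d = ⇒-elim boolean (theorem d)

  open State

  lindenbaum : (A : Pred (Formula P) ℓ) → Consistent A →
               ∃[ w ] State w × (∀ {φ} → φ ∈ A → w φ ≡ true)
  lindenbaum A consistent
    with Tukey.maximal-extension em ext (λ γs → ¬ Refutable γs) A consistent
  ... | w , A⊆w , w-consistent , w-maximal = w , state , A⊆w
    where
    w-true : Pred (Formula P) 0ℓ
    w-true φ = w φ ≡ true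

    -- If `~ φ` is not derivable from `w`, adding `φ` keeps consistency, so maximality already puts
    -- `φ` in `w`.
    complete : ∀ φ → w φ ≡ true ⊎ w-true ⊩ ~ φ
    complete φ with em {w-true ⊩ ~ φ}
    ... | yes w⊩~φ = inj₂ w⊩~φ
    ... | no w⊮~φ  = inj₁ (w-maximal φ (⊮⇒consistent w⊮~φ))

    noncontradictory : ∀ {φ} → w-true ⊩ φ → w-true ⊩ ~ φ → ⊥
    noncontradictory w⊩φ w⊩~φ with ⊩-∧ w⊩φ w⊩~φ
    ... | γs , γs⊆w , d =
      w-consistent γs γs⊆w (⊢-⊫ (λ b h → ~-intro b λ t →
        ~-elim b (∧-elimʳ b (⇒-elim b h t)) (∧-elimˡ b (⇒-elim b h t))) d)

    closed : ∀ {φ} → w-true ⊩ φ → w φ ≡ true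
    closed {φ} w⊩φ = [ id , ⊥-elim ∘ noncontradictory w⊩φ ]′ (complete φ)

    w-not : ∀ φ → w (~ φ) ≡ not (w φ)
    w-not φ with w φ in φ-value
    ... | true  = ¬-not λ ~φ → noncontradictory (⊩-refl φ-value) (⊩-refl ~φ)
    ... | false = [ (λ φ-true → contradiction φ-true (not-¬ φ-value)) , closed ]′ (complete φ)

    w-and : ∀ φ ψ → w (φ ∧ ψ) ≡ w φ Bool.∧ w ψ
    w-and φ ψ = ⇔→≡ (mk⇔
      (λ h → cong₂ Bool._∧_ (closed (⊩-map (λ b → ∧-elimˡ b) (⊩-refl h)))
                            (closed (⊩-map (λ b → ∧-elimʳ b) (⊩-refl h))))
      (λ h → closed (⊩-∧ (⊩-refl (∧-conicalˡ (w φ) (w ψ) h))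
                         (⊩-refl (∧-conicalʳ (w φ) (w ψ) h)))))

    state : State w
    state = record
      { boolean = record
        { v-top = closed ([] , [] , ⊢-⇒ (λ _ → id)) ; v-~ = w-not ; v-∧ = w-and }
      ; theorem = closed ∘ ⊩-theorem
      }

  -- The modality `□` inside a state

  module _ {w : Formula P → Bool} (st : State w) where

    ▲~⁺ : ∀ {φ} → w (▲ φ) ≡ true → w (▲ ~ φ) ≡ true
    ▲~⁺ {φ} = ⇒-elim (boolean st) (w-∧-elimʳ st (theorem st (▲~-⇔ φ)))

    ▲~⁻ : ∀ {φ} → w (▲ ~ φ) ≡ true → w (▲ φ) ≡ true
    ▲~⁻ {φ} = ⇒-elim (boolean st) (w-∧-elimˡ st (theorem st (▲~-⇔ φ)))

    □-conj : ∀ {γs} → All (λ γ → w (□ γ) ≡ true) γs → w (□ (conj γs)) ≡ true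
    □-conj []       = w-∧-intro st (v-top (boolean st)) (theorem st (axiom (K▲-axiom ▲⊤)))
    □-conj (h ∷ hs) = w-∧-intro st
      (w-∧-intro st (w-∧-elimˡ st h) (w-∧-elimˡ st (□-conj hs)))
      (mp st (▲-∧ _ _) (w-∧-intro st (w-∧-elimʳ st h) (w-∧-elimʳ st (□-conj hs))))

    -- Axiom 5 for `□`, by cases on `φ`. If `φ` is true then `▲ φ` is false, and `▲5′` gives
    -- `▲ □ φ`, hence `▲ ~ □ φ`. If `φ` is false, `▲B` for `~ φ` gives `▲ (▲ ~ φ ⇒ ~ φ)`, which `R`
    -- carries to `▲ ~ □ φ`.
    □-5 : ∀ {φ} → ¬ (w (□ φ) ≡ true) → w (□ (~ □ φ)) ≡ true
    □-5 {φ} ¬□φ = w-∧-intro st ~□φ ▲~□φ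
      where
      ~□φ : w (~ □ φ) ≡ true
      ~□φ = w-~-intro st ¬□φ

      -- `□ φ` contains `▲ φ`, hence yields `▲ ~ φ` and then `~ φ`, against its other conjunct.
      B⇒~□ : ⊢ (▲ ~ φ ⇒ ~ φ) ⇒ ~ □ φ
      B⇒~□ = ⊢-⊫
        (λ b h → ⇒-intro b λ ▲~φ⇒~φ → ~-intro b λ □φ →
          ~-elim b (⇒-elim b ▲~φ⇒~φ (⇒-elim b (∧-elimʳ b h) (∧-elimʳ b □φ)))
                   (∧-elimˡ b □φ))
        (▲~-⇔ φ)

      ▲~□φ : w (▲ ~ □ φ) ≡ true
      ▲~□φ with w φ in φ-value
      ... | true  = ▲~⁺ (mp st (US (λ _ → φ) (axiom ▲5′)) (w-∧-intro st φ-value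
                      (w-~-intro st λ ▲φ → ¬□φ (w-∧-intro st φ-value ▲φ))))
      ... | false = mp st (R B⇒~□) (w-∧-intro st
                      (mp st (US (λ _ → ~ φ) (axiom ▲B)) ~φ)
                      (⇒-intro (boolean st) λ _ → ~φ))
        where
        ~φ : w (~ φ) ≡ true
        ~φ = w-~-intro st (not-¬ φ-value)

  -- The canonical model and the truth lemma

  World : Set ℓ
  World = ∃ State

  infix 4 _⟶_
  _⟶_ : World → World → Set ℓ
  (s , _) ⟶ (t , _) = ∀ {φ} → s (□ φ) ≡ true → t φ ≡ true

  ⟶-reflexive : ∀ {s} → s ⟶ s
  ⟶-reflexive {_ , st} = w-∧-elimˡ st

  -- If `□ φ` holds at `s`, then `u` has `φ` directly. Otherwise `□-5` puts `~ □ φ` into `t`,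
  -- contradicting `□ φ` there.
  ⟶-euclidean : Euclidean _⟶_
  ⟶-euclidean {s , sS} {t , tS} s⟶t s⟶u {φ} t□φ with s (□ φ) in s□φ
  ... | true  = s⟶u s□φ
  ... | false = contradiction t□φ (w-~-elim tS (s⟶t (□-5 sS (not-¬ s□φ))))

  -- If no such `t` existed, finitely many `ψ` with `□ ψ` in `s` would entail `φ`; `□-conj` and
  -- `□-mono` would then put `□ φ` into `s`.
  witness : (s : World) → ∀ {φ} → ¬ (proj₁ s (□ φ) ≡ true) →
            ∃[ t ] s ⟶ t × ¬ (proj₁ t φ ≡ true)
  witness (s , sS) {φ} ¬□φ with lindenbaum ((λ ψ → s (□ ψ) ≡ true) ∪ ｛ ~ φ ｝) (⊮⇒consistent s⊮)
    where
    s⊮ : ¬ ((λ ψ → s (□ ψ) ≡ true) ⊩ ~ ~ φ)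
    s⊮ s⊩~~φ with ⊩-map (λ b → ~~-elim b) s⊩~~φ
    ... | γs , □γs , d = ¬□φ (mp sS (□-mono d) (□-conj sS □γs))
  ... | t , tS , ⊆t = (t , tS) , (λ □ψ → ⊆t (inj₁ □ψ)) , w-~-elim tS (⊆t (inj₂ refl))

  canonical : World → Model P
  canonical s = record
    { frame = record { World = World ; nonempty = s ; _⟶_ = λ t u → t ⟶ u }
    ; val   = λ r t → Lift ℓ (proj₁ t (var r) ≡ true)
    }

  mutual
    -- For `▲ φ`, whichever of `φ` and `~ φ` is true at `s` is also boxed there, so its value passes
    -- to all successors.
    truth⁺ : ∀ o φ (s : World) → proj₁ s φ ≡ true → canonical o , s ⊨ φ
    truth⁺ o top     s h = _
    truth⁺ o (var r) s h = lift h
    truth⁺ o (~ φ)   s@(_ , sS) h = w-~-elim sS h ∘ truth⁻ o φ s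
    truth⁺ o (φ ∧ ψ) s@(_ , sS) h =
      truth⁺ o φ s (w-∧-elimˡ sS h) , truth⁺ o ψ s (w-∧-elimʳ sS h)
    truth⁺ o (▲ φ)   s@(_ , sS) h =
      (λ sφ t s⟶t → truth⁺ o φ t (s⟶t (w-∧-intro sS (truth⁻ o φ s sφ) h))) ,
      (λ ¬sφ t@(_ , tS) s⟶t tφ →
        w-~-elim tS (s⟶t (w-∧-intro sS (w-~-intro sS (¬sφ ∘ truth⁺ o φ s)) (▲~⁺ sS h)))
                    (truth⁻ o φ t tφ))

    -- If `▲ φ` fails at `s`, then so does the box of whichever of `φ` and `~ φ` is true at `s`.
    -- `witness` then gives a successor where `φ` changes value.
    truth⁻ : ∀ o φ (s : World) → canonical o , s ⊨ φ → proj₁ s φ ≡ true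
    truth⁻ o top     (_ , sS) h = v-top (boolean sS)
    truth⁻ o (var r) s h = lower h
    truth⁻ o (~ φ)   s@(_ , sS) h = w-~-intro sS (h ∘ truth⁺ o φ s)
    truth⁻ o (φ ∧ ψ) s@(_ , sS) (hφ , hψ) = w-∧-intro sS (truth⁻ o φ s hφ) (truth⁻ o ψ s hψ)
    truth⁻ o (▲ φ)   s@(w , sS) (h , k) with w (▲ φ) in ▲φ-value
    ... | true = refl
    ... | false with w φ in φ-value
    ...   | true with witness s {φ} (not-¬ ▲φ-value ∘ w-∧-elimʳ sS)
    ...     | t , s⟶t , ¬tφ =
      contradiction (truth⁻ o φ t (h (truth⁺ o φ s φ-value) t s⟶t)) ¬tφ
    truth⁻ o (▲ φ)   s@(w , sS) (h , k) | false | false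
      with witness s {~ φ} (not-¬ ▲φ-value ∘ ▲~⁻ sS ∘ w-∧-elimʳ sS)
    ... | t@(_ , tS) , s⟶t , ¬t~φ =
      contradiction
        (w-~-intro tS (k (not-¬ φ-value ∘ truth⁻ o φ s) t s⟶t ∘ truth⁺ o φ t)) ¬t~φ

  ⊩⇒derivable : ∀ {Γ φ} → Γ ⊩ φ → Derivable (KB5′▲ p q) Γ φ
  ⊩⇒derivable (γs , γs⊆Γ , d) = γs , γs⊆Γ , ⊢-⊫ (conj⇒-⋀⇒ γs _) d

  -- If `φ` is not derivable, `Γ ∪ ｛ ~ φ ｝` is consistent and extends to a state, which satisfies it
  -- in the canonical model.
  strongly-complete : StronglyComplete (KB5′▲ p q) 𝓢5-frames
  strongly-complete Γ φ entails with em {Derivable (KB5′▲ p q) Γ φ}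
  ... | yes d = d
  ... | no ¬d with lindenbaum (Γ ∪ ｛ ~ φ ｝)
                     (⊮⇒consistent (¬d ∘ ⊩⇒derivable ∘ ⊩-map (λ b → ~~-elim b)))
  ...   | w , wS , ⊆w = contradiction (λ ψ → truth⁺ s ψ s ∘ ⊆w)
      (entails (canonical s)
        ((λ {t} → ⟶-reflexive {t}) , (λ {t} {u} {v} → ⟶-euclidean {t} {u} {v})) s)
    where
    s : World
    s = w , wS

-- Transfer between the two frame classes

𝓢5⊆𝓑5 : (F : Frame ℓ) → F ∈ 𝓢5-frames → F ∈ 𝓑5-frames
𝓢5⊆𝓑5 F (rfl , eucl) = (λ st → eucl st rfl) , eucl

theorem60 : ∀ {ℓ} → ExcludedMiddle ℓ → Extensionality ℓ ℓ →
    (P : Set ℓ) (p q : P) → p ≢ q →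
    (Sound (KB5′▲ p q) 𝓑5-frames × StronglyComplete (KB5′▲ p q) 𝓑5-frames)
    × (Sound (KB5′▲ p q) 𝓢5-frames × StronglyComplete (KB5′▲ p q) 𝓢5-frames)
theorem60 em ext P p q p≢q =
  -- Completeness passes from the smaller class to the larger, soundness from the larger to the
  -- smaller.
  (sound , λ Γ φ entails → complete Γ φ λ M M∈ → entails M (𝓢5⊆𝓑5 (Model.frame M) M∈)) ,
  ((λ φ d F F∈ → sound φ d F (𝓢5⊆𝓑5 F F∈)) , complete)
  where
  sound : Sound (KB5′▲ p q) 𝓑5-frames
  sound = Soundness.theorem-valid em

  complete : StronglyComplete (KB5′▲ p q) 𝓢5-frames
  complete = Completeness.strongly-complete em ext p q p≢q
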